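{- Let $n\ge 5$ and let $G\in \Theta_n$. (1) $\mathrm{irr}_t(G)\ge 2n-4$. Equality holds if and only if the degree sequence of $G$ is $(3,3,2,\ldots,2)$, i.e. two vertices of degree $3$ and $n-2$ vertices of degree $2$. (2) If the degree sequence of $G$ is not $(3,3,2,\ldots,2)$, then $\mathrm{irr}_t(G)\ge 4n-10$. Equality holds if and only if the degree sequence of $G$ is $(3,3,3,2,\ldots,2,1)$, i.e. three vertices of degree $3$, $n-4$ vertices of degree $2$ and one vertex of degree $1$.
   Context: A bicyclic graph is a simple connected graph whose number of edges equals its number of vertices plus one. For a graph $G=(V,E)$ and $w\in V$, $d_G(w)$ is the degree of $w$. The total irregularity is $\mathrm{irr}_t(G)=\frac12\sum_{x,y\in V}|d_G(x)-d_G(y)|$, where the sum runs over all ordered pairs of vertices. Degree sequences are listed in nonincreasing order. For $p,q\ge 3$ and $l\ge 2$, the $\Theta$-graph $\theta(p,q,l)$ is the graph on $p+q-l$ vertices consisting of two cycles $C_p$ and $C_q$ that have exactly $l$ common vertices, forming a common path. Equivalently, it consists of two vertices joined by three internally disjoint paths. $\Theta_n$ denotes the set of bicyclic graphs on $n$ vertices obtained from some $\theta(p,q,l)$ by attaching trees. -}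

module Defs where

open import Axiom.UniquenessOfIdentityProofs using (module Decidable⇒UIP)
open import Level using (0ℓ)
open import Data.Fin using (Fin; toℕ)
import Data.Fin.Properties as Fin
open import Data.List using (List; allFin; cartesianProduct; filter; length; map)
open import Data.Nat using (ℕ; suc; _+_; _∸_; _≤_; _<_; _<?_; _≟_; _/_; ∣_-_∣; s≤s)
open import Data.Nat.ListAction using (sum)
open import Data.Nat.Properties
  using (≤-decTotalOrder; ≮⇒≥; <-≤-trans; ≤-trans; m≤m+n; <⇒≢; 1+n≢n; +-cancelˡ-≡; ∸-cancelʳ-≡)
open import Data.Product using (Σ-syntax; ∃₂; _×_; _,_)
open import Data.Sum using (_⊎_; inj₁; inj₂; swap) renaming (map to ⊎-map)
open import Function using (_↔_; _⇔_; Inverse; Injective)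
open import Relation.Binary using (Rel; Decidable; Symmetric; Irreflexive)
import Relation.Binary.Construct.Flip.EqAndOrd as Flip
open import Relation.Binary.Construct.Closure.ReflexiveTransitive using (Star)
open import Relation.Binary.PropositionalEquality
  using (_≡_; refl; sym; trans; cong; subst)
open import Relation.Nullary using (¬_; yes; no; contradiction)
open import Relation.Nullary.Decidable using (_×-dec_; _⊎-dec_)

import Data.List.Sort (Flip.decTotalOrder ≤-decTotalOrder) as Descending

------------------------------------------------------------------------
-- Simple graphs

record Graph (V : Set) : Set₁ where
  infix 4 _∼_ _∼?_
  field
    _∼_     : Rel V 0ℓ
    ∼-sym   : Symmetric _∼_
    ∼-irrefl : Irreflexive _≡_ _∼_
    _∼?_    : Decidable _∼_

record _≅_ {V W : Set} (G : Graph V) (H : Graph W) : Set where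
  private
    module G = Graph G
    module H = Graph H
  field
    bijection : V ↔ W
  open Inverse bijection using (to)
  field
    adjacency : ∀ x y → x G.∼ y ⇔ to x H.∼ to y

Connected : {V : Set} → Graph V → Set
Connected G = ∀ x y → Star _∼_ x y
  where open Graph G

module _ {n : ℕ} (G : Graph (Fin n)) where
  open Graph G

  degree : Fin n → ℕ
  degree v = length (filter (v ∼?_) (allFin n))

  degreeSequence : List ℕ
  degreeSequence = Descending.sort (map degree (allFin n))

  -- Each edge is counted once, as the pair (x , y) with x < y.
  numEdges : ℕ
  numEdges = length (filter (λ (x , y) → (x Fin.<? y) ×-dec (x ∼? y))
                            (cartesianProduct (allFin n) (allFin n)))

  -- The sum over ordered pairs is even by symmetry, so _/ 2 is exact.
  irrₜ : ℕ
  irrₜ = sum (map (λ (x , y) → ∣ degree x - degree y ∣)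
                  (cartesianProduct (allFin n) (allFin n))) / 2

  Bicyclic : Set
  Bicyclic = Connected G × numEdges ≡ n + 1

------------------------------------------------------------------------
-- Cycles and trees

Next : (k : ℕ) → Rel (Fin k) 0ℓ
Next k i j = suc (toℕ i) ≡ toℕ j ⊎ (suc (toℕ i) ≡ k × toℕ j ≡ 0)

private
  next-irrefl : ∀ {k} → 3 ≤ k → (i : Fin k) → ¬ Next k i i
  next-irrefl _ i (inj₁ e) = 1+n≢n e
  next-irrefl (s≤s (s≤s _)) i (inj₂ (e , z)) with () ← trans (sym e) (cong suc z)

  next? : ∀ k → Decidable (Next k)
  next? k i j = (suc (toℕ i) ≟ toℕ j) ⊎-dec ((suc (toℕ i) ≟ k) ×-dec (toℕ j ≟ 0))

cycle : (k : ℕ) → 3 ≤ k → Graph (Fin k)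
cycle k 3≤k = record
  { _∼_      = λ i j → Next k i j ⊎ Next k j i
  ; ∼-sym    = swap
  ; ∼-irrefl = λ { {i} refl (inj₁ e) → next-irrefl 3≤k i e
                 ; {i} refl (inj₂ e) → next-irrefl 3≤k i e }
  ; _∼?_     = λ i j → next? k i j ⊎-dec next? k j i
  }

Acyclic : {V : Set} → Graph V → Set
Acyclic {V} G = ∀ k (3≤k : 3 ≤ k) (f : Fin k → V) → Injective _≡_ _≡_ f →
  ¬ (∀ i j → Graph._∼_ (cycle k 3≤k) i j → Graph._∼_ G (f i) (f j))

IsTree : {V : Set} → Graph V → Set
IsTree G = Connected G × Acyclic G

------------------------------------------------------------------------
-- The graphs θ(p,q,l)

-- The last condition excludes only l = p = q, in which case the two cycles
-- would coincide instead of meeting in a path.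
record ThetaParameters (p q l : ℕ) : Set where
  field
    3≤p : 3 ≤ p
    3≤q : 3 ≤ q
    2≤l : 2 ≤ l
    l≤p : l ≤ p
    l≤q : l ≤ q
    l<p⊎l<q : l < p ⊎ l < q

-- C_p runs through the vertices 0, …, p-1 and C_q through the vertices
-- 0, …, l-1, p, …, p+q-l-1, each in this cyclic order; the common path
-- is 0, …, l-1.
module _ (p q l : ℕ) where

  labelₚ : Fin p → ℕ
  labelₚ = toℕ

  labelq : Fin q → ℕ
  labelq j with toℕ j <? l
  ... | yes _ = toℕ j
  ... | no _  = p + (toℕ j ∸ l)

-- The edges of a graph C, transported along a numbering of its vertices.
ImageEdge : ∀ {k m} → Graph (Fin k) → (Fin k → ℕ) → Rel (Fin m) 0ℓ
ImageEdge C label x y =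
  ∃₂ λ i j → Graph._∼_ C i j × label i ≡ toℕ x × label j ≡ toℕ y

private
  imageEdge? : ∀ {k m} (C : Graph (Fin k)) label → Decidable (ImageEdge {k} {m} C label)
  imageEdge? C label x y = Fin.any? λ i → Fin.any? λ j →
    Graph._∼?_ C i j ×-dec ((label i ≟ toℕ x) ×-dec (label j ≟ toℕ y))

  imageEdge-sym : ∀ {k m} (C : Graph (Fin k)) label → Symmetric (ImageEdge {k} {m} C label)
  imageEdge-sym C label (i , j , e , x , y) = j , i , Graph.∼-sym C e , y , x

  imageEdge-irrefl : ∀ {k m} (C : Graph (Fin k)) label → Injective _≡_ _≡_ label →
                     Irreflexive _≡_ (ImageEdge {k} {m} C label)
  imageEdge-irrefl C label inj refl (i , j , e , x , y) =
    Graph.∼-irrefl C (inj (trans x (sym y))) e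

  labelq-injective : ∀ p q l → l ≤ p → Injective _≡_ _≡_ (labelq p q l)
  labelq-injective p q l l≤p {i} {j} e with toℕ i <? l | toℕ j <? l
  ... | yes _   | yes _   = Fin.toℕ-injective e
  ... | yes i<l | no _    =
    contradiction e (<⇒≢ (<-≤-trans i<l (≤-trans l≤p (m≤m+n p _))))
  ... | no _    | yes j<l =
    contradiction (sym e) (<⇒≢ (<-≤-trans j<l (≤-trans l≤p (m≤m+n p _))))
  ... | no i≮l  | no j≮l  =
    Fin.toℕ-injective (∸-cancelʳ-≡ (≮⇒≥ i≮l) (≮⇒≥ j≮l) (+-cancelˡ-≡ p _ _ e))

θ : (p q l : ℕ) → ThetaParameters p q l → Graph (Fin (p + q ∸ l))
θ p q l params = record
  { _∼_      = λ x y → ImageEdge Cₚ (labelₚ p q l) x y ⊎ ImageEdge Cq (labelq p q l) x y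
  ; ∼-sym    = ⊎-map (imageEdge-sym Cₚ _) (imageEdge-sym Cq _)
  ; ∼-irrefl = λ { e (inj₁ a) → imageEdge-irrefl Cₚ _ Fin.toℕ-injective e a
                 ; e (inj₂ a) → imageEdge-irrefl Cq _ (labelq-injective p q l l≤p) e a }
  ; _∼?_     = λ x y → imageEdge? Cₚ _ x y ⊎-dec imageEdge? Cq _ x y
  }
  where
  open ThetaParameters params
  Cₚ = cycle p 3≤p
  Cq = cycle q 3≤q

------------------------------------------------------------------------
-- Attaching trees

record RootedTree : Set₁ where
  field
    order  : ℕ
    graph  : Graph (Fin order)
    isTree : IsTree graph
    root   : Fin order

-- The root of T i is identified with the vertex i of H; a one-vertex T i
-- means that nothing is attached at i.
module _ {m : ℕ} (H : Graph (Fin m)) (T : Fin m → RootedTree) where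
  private
    module H = Graph H
    module T (i : Fin m) = RootedTree (T i)

  AttachedVertex : Set
  AttachedVertex = Σ[ i ∈ Fin m ] Fin (T.order i)

  TreeEdge : Rel AttachedVertex 0ℓ
  TreeEdge (i , x) (j , y) =
    Σ[ i≡j ∈ i ≡ j ] Graph._∼_ (T.graph j) (subst (λ k → Fin (T.order k)) i≡j x) y

  CoreEdge : Rel AttachedVertex 0ℓ
  CoreEdge (i , x) (j , y) = i H.∼ j × x ≡ T.root i × y ≡ T.root j

  private
    treeEdge-sym : Symmetric TreeEdge
    treeEdge-sym {i , _} (refl , e) = refl , Graph.∼-sym (T.graph i) e

    treeEdge-irrefl : Irreflexive _≡_ TreeEdge
    treeEdge-irrefl {i , x} refl (i≡i , e) with refl ← Decidable⇒UIP.≡-irrelevant Fin._≟_ i≡i refl =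
      Graph.∼-irrefl (T.graph i) refl e

    treeEdge? : Decidable TreeEdge
    treeEdge? (i , x) (j , y) with i Fin.≟ j
    ... | no i≢j = no λ (i≡j , _) → i≢j i≡j
    ... | yes refl with Graph._∼?_ (T.graph i) x y
    ...   | yes e = yes (refl , e)
    ...   | no ¬e = no λ { (i≡i , e) →
              ¬e (subst (λ eq → Graph._∼_ (T.graph i) (subst (λ k → Fin (T.order k)) eq x) y)
                        (Decidable⇒UIP.≡-irrelevant Fin._≟_ i≡i refl) e) }

  attachTrees : Graph AttachedVertex
  attachTrees = record
    { _∼_      = λ u v → TreeEdge u v ⊎ CoreEdge u v
    ; ∼-sym    = λ { {u} {v} (inj₁ e)           → inj₁ (treeEdge-sym {u} {v} e)
                   ; {u} {v} (inj₂ (e , x , y)) → inj₂ (H.∼-sym e , y , x) }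
    ; ∼-irrefl = λ { {u} {v} e (inj₁ a)       → treeEdge-irrefl {u} {v} e a
                   ; refl (inj₂ (e , _ , _)) → H.∼-irrefl refl e }
    ; _∼?_     = λ { u@(i , x) v@(j , y) → treeEdge? u v ⊎-dec
                     ((i H.∼? j) ×-dec ((x Fin.≟ T.root i) ×-dec (y Fin.≟ T.root j))) }
    }

record Θ (n : ℕ) (G : Graph (Fin n)) : Set₁ where
  field
    bicyclic   : Bicyclic G
    {p q l}    : ℕ
    parameters : ThetaParameters p q l
    trees      : Fin (p + q ∸ l) → RootedTree
    attached   : G ≅ attachTrees (θ p q l parameters) trees

{-# OPTIONS --safe #-}

-- Suppose G has a leaves, z vertices of degree 2 and k vertices of degrees 3 + e, with s the
-- sum of the e.  The handshake lemma for n + 1 edges gives k + s = a + 2.  Discarding the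
-- pairs of vertices of degree at least 3 bounds irrₜ below by
--   M = z (k + s) + a (2k + s) + z a,
-- exactly so when these degrees agree.  For a = 1 one finds M + 10 = 4n + 3s, with minimum at
-- the degrees 3,3,3,2,…,2,1, and for a ≥ 2 one finds M + 10 > 4n.  For a = 0 only 3,3,2,…,2
-- and 4,2,…,2 remain, and the latter is impossible: the two ends of the common path of the
-- θ-graph both have degree at least 3.  The attached trees play no other role.

module Submission where

open import Defs
open import Level using (0ℓ)
open import Data.Bool using (if_then_else_)
open import Data.Fin using (Fin; zero; suc; toℕ; fromℕ<; fromℕ)
import Data.Fin as Fin
import Data.Fin.Properties as Fin
open import Data.List
  using (List; []; _∷_; _++_; allFin; cartesianProduct; filter; length; map; replicate)
import Data.List as List
open import Data.List.Membership.Propositional using (_∈_)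
open import Data.List.Membership.Propositional.Properties using (∈-filter⁺; ∈-allFin)
open import Data.List.Properties
  using (map-++; map-∘; map-cong; map-id; length-++; length-map; length-replicate;
         length-tabulate; filter-none; ++-identityʳ)
open import Data.List.Relation.Binary.Permutation.Propositional using (_↭_; ↭-sym)
import Data.List.Relation.Binary.Permutation.Propositional.Properties as ↭
open import Data.List.Relation.Unary.All using (All; []; _∷_)
import Data.List.Relation.Unary.All as All
import Data.List.Relation.Unary.All.Properties as All
open import Data.List.Relation.Unary.AllPairs using (AllPairs; []; _∷_)
open import Data.List.Relation.Unary.Any using (index)
open import Data.List.Relation.Unary.Any.Properties using (lookup-index)
open import Data.List.Relation.Unary.Sorted.TotalOrder.Properties using (Sorted⇒AllPairs)
open import Data.Nat
  using (ℕ; zero; suc; _+_; _*_; _∸_; _/_; ∣_-_∣; _≤_; _<_; _≥_; _≤?_; _<?_; s≤s; z≤n; z<s)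
open import Data.Nat.DivMod using (m*n/n≡m; /-monoˡ-≤)
open import Data.Nat.ListAction using (sum)
open import Data.Nat.ListAction.Properties using (sum-++; sum-↭)
open import Data.Nat.Properties
open import Data.Nat.Tactic.RingSolver using (solve-∀)
open import Data.Product using (∃; _×_; _,_; proj₁; proj₂)
open import Data.Sum using (_⊎_; inj₁; inj₂)
open import Data.Vec using (Vec; []; _∷_; lookup)
open import Data.Vec.Relation.Unary.All using ([]; _∷_) renaming (All to Allᵛ)
import Data.Vec.Relation.Unary.All as Allᵛ
import Data.Vec.Relation.Unary.All.Properties as Allᵛ
open import Data.Vec.Relation.Unary.AllPairs using ([]; _∷_)
open import Data.Vec.Relation.Unary.Unique.Propositional using (Unique)
import Data.Vec.Relation.Unary.Unique.Propositional.Properties as Unique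
open import Function using (_∘_; id; _⇔_; mk⇔; Equivalence; Injective; Inverse)
open import Relation.Binary using (tri<; tri≈; tri>)
open import Relation.Binary.Construct.Closure.ReflexiveTransitive using (_◅_)
import Relation.Binary.Construct.Flip.EqAndOrd as Flip
open import Relation.Binary.PropositionalEquality
open import Relation.Nullary using (¬_; Dec; does; yes; no; contradiction)
open import Relation.Nullary.Decidable using (_×-dec_)
open import Relation.Unary using (Pred; Decidable)

import Data.List.Sort (Flip.decTotalOrder ≤-decTotalOrder) as Descending

private variable
  A B : Set

-- Finite sums over lists and counting by indicators.

∑ : List A → (A → ℕ) → ℕ
∑ xs f = sum (map f xs)

∑-cong : ∀ {f g : A → ℕ} → (∀ x → f x ≡ g x) → ∀ xs → ∑ xs f ≡ ∑ xs g
∑-cong f≗g xs = cong sum (map-cong f≗g xs)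

∑-++ : ∀ (f : A → ℕ) xs ys → ∑ (xs ++ ys) f ≡ ∑ xs f + ∑ ys f
∑-++ f xs ys = trans (cong sum (map-++ f xs ys)) (sum-++ (map f xs) (map f ys))

∑-map : ∀ (g : A → B) (f : B → ℕ) xs → ∑ (map g xs) f ≡ ∑ xs (f ∘ g)
∑-map g f xs = cong sum (sym (map-∘ xs))

∑-+ : ∀ (f g : A → ℕ) xs → ∑ xs (λ x → f x + g x) ≡ ∑ xs f + ∑ xs g
∑-+ f g []       = refl
∑-+ f g (x ∷ xs) = trans (cong (f x + g x +_) (∑-+ f g xs)) (interchange (f x) (g x) _ _)
  where
  interchange : ∀ a b c d → a + b + (c + d) ≡ a + c + (b + d)
  interchange = solve-∀

∑-zero : ∀ (xs : List A) → ∑ xs (λ _ → 0) ≡ 0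
∑-zero []       = refl
∑-zero (_ ∷ xs) = ∑-zero xs

∑-swap : ∀ (f : A → B → ℕ) xs ys →
         ∑ xs (λ x → ∑ ys (f x)) ≡ ∑ ys (λ y → ∑ xs (λ x → f x y))
∑-swap f []       ys = sym (∑-zero ys)
∑-swap f (x ∷ xs) ys =
  trans (cong (∑ ys (f x) +_) (∑-swap f xs ys)) (sym (∑-+ (f x) _ ys))

∑-cartesianProduct : ∀ (f : A × B → ℕ) xs ys →
                     ∑ (cartesianProduct xs ys) f ≡ ∑ xs (λ x → ∑ ys (λ y → f (x , y)))
∑-cartesianProduct f []       ys = refl
∑-cartesianProduct f (x ∷ xs) ys =
  trans (∑-++ f (map (x ,_) ys) _)
        (cong₂ _+_ (∑-map (x ,_) f ys) (∑-cartesianProduct f xs ys))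

𝟙 : Dec A → ℕ
𝟙 a? = if does a? then 1 else 0

𝟙-yes : (a? : Dec A) → A → 𝟙 a? ≡ 1
𝟙-yes (yes _) _ = refl
𝟙-yes (no ¬a) a = contradiction a ¬a

𝟙-no : (a? : Dec A) → ¬ A → 𝟙 a? ≡ 0
𝟙-no (yes a) ¬a = contradiction a ¬a
𝟙-no (no _)  _  = refl

length-filter-∑ : ∀ {P : Pred A 0ℓ} (P? : Decidable P) xs →
                  length (filter P? xs) ≡ ∑ xs (λ x → 𝟙 (P? x))
length-filter-∑ P? []       = refl
length-filter-∑ P? (x ∷ xs) with P? x
... | yes _ = cong suc (length-filter-∑ P? xs)
... | no _  = length-filter-∑ P? xs

-- Sending an index of `ws` to the position of its entry in the filtered list is injective: equal
-- positions carry equal entries, and `ws` has no repetition.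
unique⇒≤length-filter : ∀ {n k} {P : Pred (Fin n) 0ℓ} (P? : Decidable P) {ws : Vec (Fin n) k} →
                        Unique ws → Allᵛ P ws → k ≤ length (filter P? (allFin n))
unique⇒≤length-filter {n} P? {ws} unique Pws = Fin.injective⇒≤ {f = index ∘ member} λ {i} {j} eq →
  Unique.lookup-injective unique i j (trans (lookup-index (member i))
    (trans (cong (List.lookup (filter P? (allFin n))) eq) (sym (lookup-index (member j)))))
  where
  member : ∀ i → lookup ws i ∈ filter P? (allFin n)
  member i = ∈-filter⁺ P? (∈-allFin (lookup ws i)) (Allᵛ.lookup⁺ Pws i)

-- Degrees: the handshake lemma and positivity.

module _ {n : ℕ} (G : Graph (Fin n)) where
  open Graph G

  private
    forward? : ∀ x y → Dec (x Fin.< y × x ∼ y)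
    forward? x y = (x Fin.<? y) ×-dec (x ∼? y)

    -- By trichotomy and irreflexivity, an adjacent pair is increasing in exactly one of its two
    -- orders.
    𝟙-split : ∀ x y → 𝟙 (x ∼? y) ≡ 𝟙 (forward? x y) + 𝟙 (forward? y x)
    𝟙-split x y with x ∼? y | Fin.<-cmp x y
    -- The match on `x ∼? y` also rewrites it inside `forward? x y`, which is therefore spelled out
    -- with `no ¬e` or `yes e`.
    ... | no ¬e | _ = sym (cong₂ _+_ (𝟙-no (x Fin.<? y ×-dec no ¬e) (¬e ∘ proj₂))
                                     (𝟙-no (forward? y x) (¬e ∘ ∼-sym ∘ proj₂)))
    ... | yes e | tri< x<y _ y≮x = sym (cong₂ _+_ (𝟙-yes (x Fin.<? y ×-dec yes e) (x<y , e))
                                                  (𝟙-no (forward? y x) (y≮x ∘ proj₁)))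
    ... | yes e | tri≈ _ x≡y _ = contradiction e (∼-irrefl x≡y)
    ... | yes e | tri> x≮y _ y<x = sym (cong₂ _+_ (𝟙-no (x Fin.<? y ×-dec yes e) (x≮y ∘ proj₁))
                                                  (𝟙-yes (forward? y x) (y<x , ∼-sym e)))

  -- The degree sum counts ordered adjacent pairs. `𝟙-split` divides them by orientation, and
  -- interchanging the two sums shows that either half is `numEdges G`.
  handshake : sum (map (degree G) (allFin n)) ≡ 2 * numEdges G
  handshake = begin
    ∑ V (degree G)
      ≡⟨ ∑-cong (λ x → length-filter-∑ (x ∼?_) V) V ⟩
    ∑ V (λ x → ∑ V (λ y → 𝟙 (x ∼? y)))
      ≡⟨ ∑-cong (λ x → trans (∑-cong (𝟙-split x) V) (∑-+ _ _ V)) V ⟩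
    ∑ V (λ x → ∑ V (λ y → 𝟙 (forward? x y)) + ∑ V (λ y → 𝟙 (forward? y x)))
      ≡⟨ ∑-+ _ _ V ⟩
    ∑ V (λ x → ∑ V (λ y → 𝟙 (forward? x y))) + ∑ V (λ x → ∑ V (λ y → 𝟙 (forward? y x)))
      ≡⟨ cong₂ _+_ (sym forwards) (trans (∑-swap (λ x y → 𝟙 (forward? y x)) V V)
                                         (trans (sym forwards) (sym (+-identityʳ _)))) ⟩
    2 * numEdges G ∎
    where
    open ≡-Reasoning
    V = allFin n
    forwards : numEdges G ≡ ∑ V (λ x → ∑ V (λ y → 𝟙 (forward? x y)))
    forwards = trans (length-filter-∑ (λ (x , y) → forward? x y) (cartesianProduct V V))
                     (∑-cartesianProduct (λ (x , y) → 𝟙 (forward? x y)) V V)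

  degree-≥ : ∀ {v k} {ws : Vec _ k} → Unique ws → Allᵛ (v ∼_) ws → k ≤ degree G v
  degree-≥ {v} = unique⇒≤length-filter (v ∼?_)

  -- A walk from `v` to a different vertex is nonempty, and its first edge leads to a neighbour.
  degree-positive : 2 ≤ n → Connected G → ∀ v → 1 ≤ degree G v
  degree-positive (s≤s (s≤s _)) conn v with conn v (other v)
    where
    other : ∀ {n} → Fin (suc (suc n)) → Fin (suc (suc n))
    other zero    = suc zero
    other (suc _) = zero
  -- Matching on the vertex lets `other` compute, which rules out the empty walk.
  degree-positive (s≤s (s≤s _)) conn zero    | e ◅ _ = degree-≥ ([] ∷ []) (e ∷ [])
  degree-positive (s≤s (s≤s _)) conn (suc _) | e ◅ _ = degree-≥ ([] ∷ []) (e ∷ [])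

-- Vertices with at least three neighbours.

record BranchVertex {V : Set} (G : Graph V) (v : V) : Set where
  open Graph G
  field
    {w₁ w₂ w₃} : V
    distinct   : Unique (w₁ ∷ w₂ ∷ w₃ ∷ [])
    adjacent   : Allᵛ (v ∼_) (w₁ ∷ w₂ ∷ w₃ ∷ [])

module _ {V W : Set} {G : Graph V} {H : Graph W} (f : V → W) (f-injective : Injective _≡_ _≡_ f)
         (f-hom : ∀ {x y} → Graph._∼_ G x y → Graph._∼_ H (f x) (f y)) where

  -- Storing three neighbours as witnesses, rather than a bound on the degree, lets a branch vertex
  -- be carried along any injective homomorphism.
  BranchVertex-map : ∀ {v} → BranchVertex G v → BranchVertex H (f v)
  BranchVertex-map b = record
    { distinct = Unique.map⁺ f-injective (BranchVertex.distinct b)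
    ; adjacent = Allᵛ.map⁺ (Allᵛ.map f-hom (BranchVertex.adjacent b))
    }

-- The two ends of the common path of a θ-graph.

module _ {p q l : ℕ} (params : ThetaParameters p q l) where
  open ThetaParameters params
  open Graph (θ p q l params)

  private
    m : ℕ
    m = p + q ∸ l

    m≡ : p + (q ∸ l) ≡ m
    m≡ = sym (+-∸-assoc p l≤q)

  labelq-low : ∀ j → toℕ j < l → labelq p q l j ≡ toℕ j
  labelq-low j j<l with toℕ j <? l
  ... | yes _  = refl
  ... | no j≮l = contradiction j<l j≮l

  labelq-high : ∀ j → l ≤ toℕ j → p ≤ labelq p q l j
  labelq-high j l≤j with toℕ j <? l
  ... | yes j<l = contradiction l≤j (<⇒≱ j<l)
  ... | no _    = m≤m+n p _

  labelq<m : ∀ j → labelq p q l j < m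
  labelq<m j with toℕ j <? l
  ... | yes j<l = subst (toℕ j <_) m≡ (<-≤-trans j<l (≤-trans l≤p (m≤m+n p _)))
  ... | no j≮l  = subst (p + (toℕ j ∸ l) <_) m≡
                    (+-monoʳ-< p (∸-monoˡ-< (Fin.toℕ<n j) (≮⇒≥ j≮l)))

  labelₚ<m : ∀ (i : Fin p) → toℕ i < m
  labelₚ<m i = subst (toℕ i <_) m≡ (<-≤-trans (Fin.toℕ<n i) (m≤m+n p _))

  vertexₚ : Fin p → Fin m
  vertexₚ i = fromℕ< (labelₚ<m i)

  vertexq : Fin q → Fin m
  vertexq j = fromℕ< (labelq<m j)

  toℕ-vertexₚ : ∀ i → toℕ (vertexₚ i) ≡ toℕ i
  toℕ-vertexₚ i = Fin.toℕ-fromℕ< (labelₚ<m i)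

  toℕ-vertexq : ∀ j → toℕ (vertexq j) ≡ labelq p q l j
  toℕ-vertexq j = Fin.toℕ-fromℕ< (labelq<m j)

  edgeₚ : ∀ {i j} → Graph._∼_ (cycle p 3≤p) i j → vertexₚ i ∼ vertexₚ j
  edgeₚ {i} {j} e = inj₁ (i , j , e , sym (toℕ-vertexₚ i) , sym (toℕ-vertexₚ j))

  edgeq : ∀ {i j} → Graph._∼_ (cycle q 3≤q) i j → vertexq i ∼ vertexq j
  edgeq {i} {j} e = inj₂ (i , j , e , sym (toℕ-vertexq i) , sym (toℕ-vertexq j))

  vertexₚ≡vertexq : ∀ {i j} → toℕ j < l → toℕ i ≡ toℕ j → vertexₚ i ≡ vertexq j
  vertexₚ≡vertexq {i} {j} j<l i≡j = Fin.toℕ-injective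
    (trans (toℕ-vertexₚ i) (trans i≡j (sym (trans (toℕ-vertexq j) (labelq-low j j<l)))))

  private
    vertexₚ≢vertexₚ : ∀ i i′ → toℕ i ≢ toℕ i′ → vertexₚ i ≢ vertexₚ i′
    vertexₚ≢vertexₚ i i′ i≢i′ eq =
      i≢i′ (trans (sym (toℕ-vertexₚ i)) (trans (cong toℕ eq) (toℕ-vertexₚ i′)))

    -- Off the common path the labels of C_q are at least `p`, beyond every label of C_p, so labels
    -- need comparing only when `toℕ j < l`.
    vertexₚ≢vertexq : ∀ i j → (toℕ j < l → toℕ i ≢ toℕ j) → vertexₚ i ≢ vertexq j
    vertexₚ≢vertexq i j i≢j eq with <-≤-connex (toℕ j) l
    ... | inj₁ j<l = i≢j j<l (trans labels≡ (labelq-low j j<l))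
      where labels≡ = trans (sym (toℕ-vertexₚ i)) (trans (cong toℕ eq) (toℕ-vertexq j))
    ... | inj₂ l≤j = <⇒≱ (Fin.toℕ<n i) (subst (p ≤_) (sym labels≡) (labelq-high j l≤j))
      where labels≡ = trans (sym (toℕ-vertexₚ i)) (trans (cong toℕ eq) (toℕ-vertexq j))

  -- The three neighbours of vertex 0 are vertex 1 and the last vertices of C_p and of C_q.
  start-branch : ∀ {i} → toℕ i ≡ 0 → BranchVertex (θ p q l params) (vertexₚ i)
  start-branch {i} i≡0 = record
    { distinct = (vertexₚ≢vertexₚ second lastₚ 1≢last ∷ vertexₚ≢vertexq second lastq (λ _ → 1≢last′) ∷ [])
               ∷ (vertexₚ≢vertexq lastₚ lastq lasts≢ ∷ []) ∷ [] ∷ []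
    ; adjacent = edgeₚ (inj₁ (inj₁ (trans (cong suc i≡0) (sym second≡))))
               ∷ edgeₚ (inj₂ (inj₂ (lastₚ≡ , i≡0)))
               -- Vertex 0 has a name in each cycle; the edge of C_q is transported to the name from
               -- C_p.
               ∷ subst (_∼ vertexq lastq) (sym (vertexₚ≡vertexq 0<l (trans i≡0 (sym firstq≡))))
                       (edgeq (inj₂ (inj₂ (lastq≡ , firstq≡)))) ∷ []
    }
    where
    last : ∀ {k} → 3 ≤ k → ∃ λ (j : Fin k) → suc (toℕ j) ≡ k
    last (s≤s {n = k} _) = fromℕ k , cong suc (Fin.toℕ-fromℕ k)
    second : Fin p
    second = fromℕ< (≤-trans (n≤1+n 2) 3≤p)
    second≡ : toℕ second ≡ 1
    second≡ = Fin.toℕ-fromℕ< _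
    lastₚ = proj₁ (last 3≤p)
    lastₚ≡ = proj₂ (last 3≤p)
    lastq = proj₁ (last 3≤q)
    lastq≡ = proj₂ (last 3≤q)
    firstq : Fin q
    firstq = fromℕ< (m<n⇒0<n 3≤q)
    firstq≡ : toℕ firstq ≡ 0
    firstq≡ = Fin.toℕ-fromℕ< _
    0<l : toℕ firstq < l
    0<l = subst (_< l) (sym firstq≡) (m<n⇒0<n 2≤l)
    1≢last : toℕ second ≢ toℕ lastₚ
    1≢last e = <⇒≢ 3≤p (trans (cong suc (trans (sym second≡) e)) lastₚ≡)
    1≢last′ : toℕ second ≢ toℕ lastq
    1≢last′ e = <⇒≢ 3≤q (trans (cong suc (trans (sym second≡) e)) lastq≡)
    -- A last vertex of C_q on the common path gives q ≤ l, and agreement with the last vertex of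
    -- C_p then gives p ≤ l; `l<p⊎l<q` forbids having both.
    lasts≢ : toℕ lastq < l → toℕ lastₚ ≢ toℕ lastq
    lasts≢ lastq<l e with l<p⊎l<q
    ... | inj₁ l<p = <⇒≱ l<p (subst (_≤ l) (trans (cong suc (sym e)) lastₚ≡) lastq<l)
    ... | inj₂ l<q = <⇒≱ l<q (subst (_≤ l) lastq≡ lastq<l)

  -- The three neighbours of vertex l - 1 are its predecessor l - 2 and its successors on C_p and on
  -- C_q. A successor wraps around to 0 when the common path exhausts that cycle.
  end-branch : ∀ {i} → suc (toℕ i) ≡ l → BranchVertex (θ p q l params) (vertexₚ i)
  end-branch {i} i≡ = record
    { distinct = (vertexₚ≢vertexₚ predₚ succₚ (succ≢ 3≤p refl succₚ-next) ∷
                    vertexₚ≢vertexq predₚ succq (λ _ → succ≢ 3≤q iq≡ succq-next) ∷ [])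
               ∷ (vertexₚ≢vertexq succₚ succq succs≢ ∷ []) ∷ [] ∷ []
    ; adjacent = edgeₚ (inj₂ (inj₁ (trans (cong suc pred≡) (sym i≡pred))))
               ∷ edgeₚ (inj₁ succₚ-next)
               ∷ subst (_∼ vertexq succq) (sym (vertexₚ≡vertexq iq<l (sym iq≡)))
                       (edgeq (inj₁ succq-next)) ∷ []
    }
    where
    next : ∀ {k} (j : Fin k) → ∃ (Next k j)
    next {suc k} j with suc (toℕ j) <? suc k
    ... | yes j+1<k = fromℕ< j+1<k , inj₁ (sym (Fin.toℕ-fromℕ< j+1<k))
    ... | no j+1≮k  = zero , inj₂ (≤-antisym (Fin.toℕ<n j) (≮⇒≥ j+1≮k) , refl)
    i≡l∸1 : toℕ i ≡ l ∸ 1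
    i≡l∸1 = cong (_∸ 1) i≡
    i≡pred : toℕ i ≡ suc (l ∸ 2)
    i≡pred = trans i≡l∸1 (+-∸-assoc 1 2≤l)
    i<l : toℕ i < l
    i<l = ≤-reflexive i≡
    predₚ : Fin p
    predₚ = fromℕ< (<-≤-trans (∸-monoʳ-< {l} z<s 2≤l) l≤p)
    pred≡ : toℕ predₚ ≡ l ∸ 2
    pred≡ = Fin.toℕ-fromℕ< _
    iq : Fin q
    iq = fromℕ< (<-≤-trans i<l l≤q)
    iq≡ : toℕ iq ≡ toℕ i
    iq≡ = Fin.toℕ-fromℕ< _
    iq<l : toℕ iq < l
    iq<l = subst (_< l) (sym iq≡) i<l
    succₚ = proj₁ (next i)
    succₚ-next = proj₂ (next i)
    succq = proj₁ (next iq)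
    succq-next = proj₂ (next iq)
    iq+1≡l : suc (toℕ iq) ≡ l
    iq+1≡l = trans (cong suc iq≡) i≡
    -- Without wrap-around the labels are l - 2 and l. With it, equality would force l - 2 = 0 and
    -- hence a cycle of length 2.
    succ≢ : ∀ {k} {i′ j : Fin k} → 3 ≤ k → toℕ i′ ≡ toℕ i → Next k i′ j →
            toℕ predₚ ≢ toℕ j
    succ≢ _ i′≡i (inj₁ i′+1≡j) e =
      <⇒≢ (subst (l ∸ 2 <_) i′+1≡l′ (<-trans ≤-refl ≤-refl)) (trans (sym pred≡) e)
      where i′+1≡l′ = trans (cong suc (trans (sym i≡pred) (sym i′≡i))) i′+1≡j
    succ≢ 3≤k i′≡i (inj₂ (i′+1≡k , j≡0)) e =
      <⇒≢ 3≤k (trans (cong (2 +_) (trans (sym (trans e j≡0)) pred≡))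
                     (trans (cong suc (trans (sym i≡pred) (sym i′≡i))) i′+1≡k))
    -- A successor on C_q that lies on the common path must be the wrapped one. If it equals the
    -- successor on C_p, that one wraps too, so p = q = l.
    succs≢ : toℕ succq < l → toℕ succₚ ≢ toℕ succq
    succs≢ succq<l e with succₚ-next | succq-next
    ... | _ | inj₁ eq = <⇒≢ succq<l (trans (sym eq) iq+1≡l)
    ... | inj₁ eq | inj₂ (_ , 0≡) with () ← trans eq (trans e 0≡)
    ... | inj₂ (eqp , _) | inj₂ (eqq , _) with l<p⊎l<q
    ...   | inj₁ l<p = <⇒≢ l<p (trans (sym i≡) eqp)
    ...   | inj₂ l<q = <⇒≢ l<q (trans (sym iq+1≡l) eqq)

-- Transfer of the branch vertices to G.

module _ {n : ℕ} {G : Graph (Fin n)} (ΘG : Θ n G) where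
  open Θ ΘG
  open ThetaParameters parameters
  open Inverse (_≅_.bijection attached)

  private
    core : Fin (p + q ∸ l) → Fin n
    core i = from (i , RootedTree.root (trees i))

    core-injective : Injective _≡_ _≡_ core
    core-injective {i} {j} eq = cong proj₁
      (trans (sym (strictlyInverseˡ (i , _))) (trans (cong to eq) (strictlyInverseˡ (j , _))))

    core-hom : ∀ {i j} → Graph._∼_ (θ p q l parameters) i j → Graph._∼_ G (core i) (core j)
    core-hom {i} {j} e = Equivalence.from (_≅_.adjacency attached _ _)
      (subst₂ (Graph._∼_ (attachTrees (θ p q l parameters) trees))
              (sym (strictlyInverseˡ (i , _))) (sym (strictlyInverseˡ (j , _)))
              (inj₂ (e , refl , refl)))

    3≤degree : ∀ {i} → BranchVertex (θ p q l parameters) i → 3 ≤ degree G (core i)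
    3≤degree b = degree-≥ G (BranchVertex.distinct b′) (BranchVertex.adjacent b′)
      where b′ = BranchVertex-map {H = G} core core-injective core-hom b

  -- The roots of the attached trees embed the θ-graph in G, so both ends of its common path keep
  -- three neighbours; they are distinct because l ≥ 2.
  2≤branchings : 2 ≤ length (filter (λ v → 3 ≤? degree G v) (allFin n))
  2≤branchings = unique⇒≤length-filter (λ v → 3 ≤? degree G v)
    ((core≢ ∷ []) ∷ [] ∷ [])
    (3≤degree (start-branch parameters first≡) ∷ 3≤degree (end-branch parameters last≡) ∷ [])
    where
    first last : Fin p
    first = fromℕ< (m<n⇒0<n 3≤p)
    last = fromℕ< (<-≤-trans (∸-monoʳ-< {l} z<s (m<n⇒0<n 2≤l)) l≤p)
    first≡ : toℕ first ≡ 0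
    first≡ = Fin.toℕ-fromℕ< _
    last≡ : suc (toℕ last) ≡ l
    last≡ = trans (cong suc (Fin.toℕ-fromℕ< _)) (sym (+-∸-assoc 1 (m<n⇒0<n 2≤l)))
    core≢ : core (vertexₚ parameters first) ≢ core (vertexₚ parameters last)
    core≢ eq = <⇒≢ 2≤l (trans (cong suc (trans (sym first≡) labels≡)) last≡)
      where
      labels≡ : toℕ first ≡ toℕ last
      labels≡ = trans (sym (toℕ-vertexₚ parameters first))
                  (trans (cong toℕ (core-injective eq)) (toℕ-vertexₚ parameters last))

-- Sums of pairwise differences and degree profiles.

∑-↭ : ∀ (f : A → ℕ) {xs ys} → xs ↭ ys → ∑ xs f ≡ ∑ ys f
∑-↭ f xs↭ys = sum-↭ (↭.map⁺ f xs↭ys)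

∑-replicate : ∀ (f : A → ℕ) z x → ∑ (replicate z x) f ≡ z * f x
∑-replicate f zero    x = refl
∑-replicate f (suc z) x = cong (f x +_) (∑-replicate f z x)

-- For the list of degrees of a graph, `gaps ds ds` is the sum over ordered pairs, that is, twice
-- the total irregularity.
gaps : List ℕ → List ℕ → ℕ
gaps xs ys = ∑ xs λ x → ∑ ys λ y → ∣ x - y ∣

gaps-↭ : ∀ {xs ys} → xs ↭ ys → gaps xs xs ≡ gaps ys ys
gaps-↭ {xs} xs↭ys = trans (∑-cong (λ x → ∑-↭ _ xs↭ys) xs) (∑-↭ _ xs↭ys)

gaps-comm : ∀ xs ys → gaps xs ys ≡ gaps ys xs
gaps-comm xs ys = trans (∑-swap ∣_-_∣ xs ys)
  (∑-cong (λ y → ∑-cong (λ x → ∣-∣-comm x y) xs) ys)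

gaps-++ : ∀ xs ys → gaps (xs ++ ys) (xs ++ ys) ≡ gaps xs xs + 2 * gaps ys xs + gaps ys ys
gaps-++ xs ys = begin
  gaps (xs ++ ys) (xs ++ ys)                              ≡⟨ ∑-++ _ xs ys ⟩
  gaps xs (xs ++ ys) + gaps ys (xs ++ ys)                 ≡⟨ cong₂ _+_ (split xs) (split ys) ⟩
  gaps xs xs + gaps xs ys + (gaps ys xs + gaps ys ys)     ≡⟨ cong (λ g → gaps xs xs + g + (gaps ys xs + gaps ys ys))
                                                                 (gaps-comm xs ys) ⟩
  gaps xs xs + gaps ys xs + (gaps ys xs + gaps ys ys)     ≡⟨ collect (gaps xs xs) (gaps ys xs) (gaps ys ys) ⟩
  gaps xs xs + 2 * gaps ys xs + gaps ys ys                ∎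
  where
  open ≡-Reasoning
  split : ∀ zs → gaps zs (xs ++ ys) ≡ gaps zs xs + gaps zs ys
  split zs = trans (∑-cong (λ z → ∑-++ _ xs ys) zs) (∑-+ _ _ zs)
  collect : ∀ a b c → a + b + (b + c) ≡ a + 2 * b + c
  collect = solve-∀

-- profile es z a lists the degrees of a graph with z vertices of degree 2, a leaves, and
-- one vertex of degree 3 + e for each e in es.
high : List ℕ → List ℕ
high = map (3 +_)

profile : List ℕ → ℕ → ℕ → List ℕ
profile es z a = high es ++ (replicate z 2 ++ replicate a 1)

profile-length : ∀ es z a → length (profile es z a) ≡ length es + (z + a)
profile-length es z a = trans (length-++ (high es)) (cong₂ _+_ (length-map _ es)
  (trans (length-++ (replicate z 2)) (cong₂ _+_ (length-replicate z) (length-replicate a))))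

∑-low : ∀ (f : ℕ → ℕ) z a → ∑ (replicate z 2 ++ replicate a 1) f ≡ z * f 2 + a * f 1
∑-low f z a = trans (∑-++ f (replicate z 2) _) (cong₂ _+_ (∑-replicate f z 2) (∑-replicate f a 1))

∑-high : ∀ c es → ∑ es (c +_) ≡ c * length es + sum es
∑-high c []       = sym (trans (+-identityʳ _) (*-zeroʳ c))
∑-high c (e ∷ es) = trans (cong (c + e +_) (∑-high c es)) (step c e (length es) (sum es))
  where
  step : ∀ c e k s → c + e + (c * k + s) ≡ c * suc k + (e + s)
  step = solve-∀

profile-sum : ∀ es z a → sum (profile es z a) ≡ 3 * length es + sum es + (z * 2 + a * 1)
profile-sum es z a = begin
  sum (profile es z a)        ≡⟨ cong sum (map-id (profile es z a)) ⟨
  ∑ (profile es z a) (λ x → x) ≡⟨ ∑-++ _ (high es) _ ⟩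
  ∑ (high es) (λ x → x) + ∑ (replicate z 2 ++ replicate a 1) (λ x → x)
                              ≡⟨ cong₂ _+_ (trans (∑-map _ _ es) (∑-high 3 es)) (∑-low _ z a) ⟩
  3 * length es + sum es + (z * 2 + a * 1) ∎
  where
  open ≡-Reasoning

-- Half the contribution to gaps of the pairs of entries from different blocks of a profile,
-- with k = length es and s = sum es.
mixedGaps : ℕ → ℕ → ℕ → ℕ → ℕ
mixedGaps k s z a = z * (k + s) + a * (2 * k + s) + z * a

-- The differences among degrees of at least 3 stay unevaluated: they vanish when these degrees
-- agree and are dropped from the lower bound otherwise.
gaps-profile : ∀ es z a → gaps (profile es z a) (profile es z a) ≡
               gaps (high es) (high es) + mixedGaps (length es) (sum es) z a * 2
gaps-profile es z a = begin
  gaps (profile es z a) (profile es z a)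
    ≡⟨ gaps-++ (high es) low ⟩
  gaps (high es) (high es) + 2 * gaps low (high es) + gaps low low
    ≡⟨ cong₂ (λ g h → gaps (high es) (high es) + 2 * g + h)
        (trans (∑-low (λ x → ∑ (high es) ∣ x -_∣) z a)
               -- The degree 3 + e exceeds 2 by 1 + e and exceeds 1 by 2 + e, whence the constants 1
               -- and 2.
               (cong₂ (λ g h → z * g + a * h) (trans (∑-map _ _ es) (∑-high 1 es))
                                              (trans (∑-map _ _ es) (∑-high 2 es))))
        (trans (∑-low (λ x → ∑ low ∣ x -_∣) z a)
               (cong₂ (λ g h → z * g + a * h) (∑-low ∣ 2 -_∣ z a) (∑-low ∣ 1 -_∣ z a))) ⟩
  gaps (high es) (high es) + 2 * (z * (1 * k + s) + a * (2 * k + s))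
    + (z * (z * 0 + a * 1) + a * (z * 1 + a * 0))
    ≡⟨ collect (gaps (high es) (high es)) k s z a ⟩
  gaps (high es) (high es) + mixedGaps k s z a * 2 ∎
  where
  open ≡-Reasoning
  low = replicate z 2 ++ replicate a 1
  k = length es
  s = sum es
  collect : ∀ g k s z a →
    g + 2 * (z * (1 * k + s) + a * (2 * k + s)) + (z * (z * 0 + a * 1) + a * (z * 1 + a * 0))
    ≡ g + (z * (k + s) + a * (2 * k + s) + z * a) * 2
  collect = solve-∀

-- Every nonincreasing list of positive numbers is a profile.

record Profile (ds : List ℕ) : Set where
  field
    es  : List ℕ
    z a : ℕ
    ds≡ : ds ≡ profile es z a

-- Entries are added in front of a profiled tail. Since the head dominates the tail, a 2 can only
-- precede a tail without high entries, and a 1 only a tail of ones.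
profile-of : ∀ {ds} → AllPairs _≥_ ds → All (1 ≤_) ds → Profile ds
profile-of []           []           = record { es = [] ; z = 0 ; a = 0 ; ds≡ = refl }
profile-of (x≥ ∷ xs↘) (s≤s z≤n ∷ xs≥1) with profile-of xs↘ xs≥1
profile-of {suc (suc (suc e)) ∷ _} (_ ∷ _) (_ ∷ _) | record { es = es ; z = z ; a = a ; ds≡ = refl } =
  record { es = e ∷ es ; z = z ; a = a ; ds≡ = refl }
profile-of {2 ∷ _} (_ ∷ _) (_ ∷ _) | record { es = [] ; z = z ; a = a ; ds≡ = refl } =
  record { es = [] ; z = suc z ; a = a ; ds≡ = refl }
profile-of {2 ∷ _} ((s≤s (s≤s ()) ∷ _) ∷ _) (_ ∷ _) | record { es = _ ∷ _ ; ds≡ = refl }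
profile-of {1 ∷ _} (_ ∷ _) (_ ∷ _) | record { es = [] ; z = zero ; a = a ; ds≡ = refl } =
  record { es = [] ; z = 0 ; a = suc a ; ds≡ = refl }
profile-of {1 ∷ _} ((s≤s () ∷ _) ∷ _) (_ ∷ _) | record { es = [] ; z = suc _ ; ds≡ = refl }
profile-of {1 ∷ _} ((s≤s () ∷ _) ∷ _) (_ ∷ _) | record { es = _ ∷ _ ; ds≡ = refl }

filter-profile : ∀ es z a → length (filter (3 ≤?_) (profile es z a)) ≡ length es
filter-profile []       z a = cong length (filter-none (3 ≤?_) (low z))
  where
  low₁ : ∀ a → All (λ d → ¬ 3 ≤ d) (replicate a 1)
  low₁ zero    = []
  low₁ (suc a) = (λ { (s≤s ()) }) ∷ low₁ a
  low : ∀ z → All (λ d → ¬ 3 ≤ d) (replicate z 2 ++ replicate a 1)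
  low zero    = low₁ a
  low (suc z) = (λ { (s≤s (s≤s ())) }) ∷ low z
filter-profile (e ∷ es) z a = cong suc (filter-profile es z a)

-- Arithmetic of the possible profiles.

sum≡0⇒replicate : ∀ es → sum es ≡ 0 → es ≡ replicate (length es) 0
sum≡0⇒replicate []          _   = refl
sum≡0⇒replicate (zero ∷ es) s≡0 = cong (0 ∷_) (sum≡0⇒replicate es s≡0)

-- A degree sum of 2(n + 1) means that the differences d - 2 add up to 2; a leaf contributes -1 and
-- a vertex of degree 3 + e contributes 1 + e.
excess≡deficiency : ∀ k s z a → 3 * k + s + (z * 2 + a * 1) ≡ 2 * (k + (z + a) + 1) → k + s ≡ a + 2
excess≡deficiency k s z a eq = +-cancelʳ-≡ (2 * (k + z) + a) _ _
  (trans (expandˡ k s z a) (trans eq (expandʳ k z a)))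
  where
  expandˡ : ∀ k s z a → k + s + (2 * (k + z) + a) ≡ 3 * k + s + (z * 2 + a * 1)
  expandˡ = solve-∀
  expandʳ : ∀ k z a → 2 * (k + (z + a) + 1) ≡ a + 2 + (2 * (k + z) + a)
  expandʳ = solve-∀

-- The difference of the two sides is three times the total excess `suc s`, which is positive.
4n<10+mixedGaps-oneLeaf : ∀ k s z → k + suc s ≡ 3 →
                          4 * (k + (z + 1)) < 10 + mixedGaps k (suc s) z 1
4n<10+mixedGaps-oneLeaf k s z k+s≡3 = subst (4 * (k + (z + 1)) <_) (sym slack) (m<m+n _ z<s)
  where
  open ≡-Reasoning
  expand : ∀ k s z → 10 + (z * (k + s) + 1 * (2 * k + s) + z * 1) ≡ 10 + k + z + (z + 1) * (k + s)
  expand = solve-∀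
  regroup : ∀ k z → 10 + k + z + (z + 1) * 3 ≡ 4 + 4 * z + k + 3 * 3
  regroup = solve-∀
  contract : ∀ k s z → 4 + 4 * z + k + 3 * (k + s) ≡ 4 * (k + (z + 1)) + 3 * s
  contract = solve-∀
  slack : 10 + mixedGaps k (suc s) z 1 ≡ 4 * (k + (z + 1)) + 3 * suc s
  slack = begin
    10 + mixedGaps k (suc s) z 1          ≡⟨ expand k (suc s) z ⟩
    10 + k + z + (z + 1) * (k + suc s)    ≡⟨ cong (λ t → 10 + k + z + (z + 1) * t) k+s≡3 ⟩
    10 + k + z + (z + 1) * 3              ≡⟨ regroup k z ⟩
    -- The constant 9 is turned back into three copies of `k + suc s`, which completes `k` to
    -- `4 * k`.
    4 + 4 * z + k + 3 * 3                 ≡⟨ cong (λ t → 4 + 4 * z + k + 3 * t) k+s≡3 ⟨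
    4 + 4 * z + k + 3 * (k + suc s)       ≡⟨ contract k (suc s) z ⟩
    4 * (k + (z + 1)) + 3 * suc s         ∎

-- Writing the number of leaves as 2 + b gives the difference of the two sides nonnegative
-- coefficients and the constant term 2, hence strictness.
4n<10+mixedGaps-manyLeaves : ∀ k s z b → k + s ≡ 2 + b + 2 →
                             4 * (k + (z + (2 + b))) < 10 + mixedGaps k s z (2 + b)
4n<10+mixedGaps-manyLeaves k s z b k+s≡ =
  subst (4 * (k + (z + (2 + b))) <_) (sym slack) (m<m+n _ z<s)
  where
  open ≡-Reasoning
  expand : ∀ k s z b → 10 + (z * (k + s) + (2 + b) * (2 * k + s) + z * (2 + b)) ≡
           10 + (2 + b) * (k + z) + (z + (2 + b)) * (k + s)
  expand = solve-∀
  regroup : ∀ k z b → 10 + (2 + b) * (k + z) + (z + (2 + b)) * (2 + b + 2) ≡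
            10 + 4 * b + z * (2 * b + 6) + b * b + 2 * k + b * k + 2 * (2 + b + 2)
  regroup = solve-∀
  contract : ∀ k s z b → 10 + 4 * b + z * (2 * b + 6) + b * b + 2 * k + b * k + 2 * (k + s) ≡
             4 * (k + (z + (2 + b))) + (2 + (z * (2 * b + 2) + 2 * s + b * b + b * k))
  contract = solve-∀
  slack : 10 + mixedGaps k s z (2 + b) ≡
          4 * (k + (z + (2 + b))) + (2 + (z * (2 * b + 2) + 2 * s + b * b + b * k))
  slack = begin
    10 + mixedGaps k s z (2 + b)                                         ≡⟨ expand k s z b ⟩
    10 + (2 + b) * (k + z) + (z + (2 + b)) * (k + s)
      ≡⟨ cong (λ t → 10 + (2 + b) * (k + z) + (z + (2 + b)) * t) k+s≡ ⟩
    10 + (2 + b) * (k + z) + (z + (2 + b)) * (2 + b + 2)                 ≡⟨ regroup k z b ⟩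
    10 + 4 * b + z * (2 * b + 6) + b * b + 2 * k + b * k + 2 * (2 + b + 2)
      ≡⟨ cong (λ t → 10 + 4 * b + z * (2 * b + 6) + b * b + 2 * k + b * k + 2 * t) k+s≡ ⟨
    10 + 4 * b + z * (2 * b + 6) + b * b + 2 * k + b * k + 2 * (k + s)   ≡⟨ contract k s z b ⟩
    4 * (k + (z + (2 + b))) + (2 + (z * (2 * b + 2) + 2 * s + b * b + b * k)) ∎

-- The cases are a = 0, a = 1 and a ≥ 2. For a = 0 the bound `2 ≤ length es` excludes `es ≡ 1 ∷ []`,
-- the degrees 4, 2, ..., 2.
classify : ∀ es z a → 2 ≤ length es → length es + sum es ≡ a + 2 →
           (es ≡ 0 ∷ 0 ∷ [] × a ≡ 0) ⊎ (es ≡ 0 ∷ 0 ∷ 0 ∷ [] × a ≡ 1) ⊎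
           4 * (length es + (z + a)) < 10 + mixedGaps (length es) (sum es) z a
classify es z zero 2≤k k+s≡2 =
  inj₁ (trans (sum≡0⇒replicate es s≡0) (cong (λ k → replicate k 0) k≡2) , refl)
  where
  k≡2 : length es ≡ 2
  k≡2 = ≤-antisym (subst (length es ≤_) k+s≡2 (m≤m+n _ _)) 2≤k
  s≡0 : sum es ≡ 0
  s≡0 = +-cancelˡ-≡ 2 _ _ (trans (cong (_+ sum es) (sym k≡2)) k+s≡2)
classify es z (suc zero) _ k+s≡3 with sum es in s≡
... | zero  = inj₂ (inj₁ (trans (sum≡0⇒replicate es s≡) (cong (λ k → replicate k 0) k≡3) , refl))
  where k≡3 = trans (sym (+-identityʳ (length es))) k+s≡3
... | suc s = inj₂ (inj₂ (4n<10+mixedGaps-oneLeaf (length es) s z k+s≡3))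
classify es z (suc (suc b)) _ k+s≡ =
  inj₂ (inj₂ (4n<10+mixedGaps-manyLeaves (length es) (sum es) z b k+s≡))

-- Total irregularity computed from the degree sequence.

module _ {n : ℕ} (G : Graph (Fin n)) where
  private
    V = allFin n
    degrees = map (degree G) V

    sorted↭ : degreeSequence G ↭ degrees
    sorted↭ = Descending.sort-↭ degrees

  irrₜ-gaps : irrₜ G ≡ gaps (degreeSequence G) (degreeSequence G) / 2
  irrₜ-gaps = cong (_/ 2) (begin
    ∑ (cartesianProduct V V) (λ (x , y) → ∣ degree G x - degree G y ∣)
      ≡⟨ ∑-cartesianProduct _ V V ⟩
    ∑ V (λ x → ∑ V (λ y → ∣ degree G x - degree G y ∣))
      ≡⟨ ∑-cong (λ x → ∑-map (degree G) ∣ degree G x -_∣ V) V ⟨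
    ∑ V (λ x → ∑ degrees ∣ degree G x -_∣)
      ≡⟨ ∑-map (degree G) _ V ⟨
    gaps degrees degrees
      ≡⟨ gaps-↭ sorted↭ ⟨
    gaps (degreeSequence G) (degreeSequence G) ∎)
    where open ≡-Reasoning

  length-degreeSequence : length (degreeSequence G) ≡ n
  length-degreeSequence = trans (↭.↭-length sorted↭) (trans (length-map _ V) (length-tabulate id))

  sum-degreeSequence : sum (degreeSequence G) ≡ 2 * numEdges G
  sum-degreeSequence = trans (sum-↭ sorted↭) (handshake G)

  filter-degreeSequence : length (filter (3 ≤?_) (degreeSequence G)) ≡
                          length (filter (λ v → 3 ≤? degree G v) V)
  filter-degreeSequence = begin
    length (filter (3 ≤?_) (degreeSequence G))    ≡⟨ ↭.↭-length (↭.filter-↭ (3 ≤?_) sorted↭) ⟩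
    length (filter (3 ≤?_) degrees)               ≡⟨ length-filter-∑ (3 ≤?_) degrees ⟩
    ∑ degrees (λ d → 𝟙 (3 ≤? d))                  ≡⟨ ∑-map (degree G) _ V ⟩
    ∑ V (λ v → 𝟙 (3 ≤? degree G v))               ≡⟨ length-filter-∑ (λ v → 3 ≤? degree G v) V ⟨
    length (filter (λ v → 3 ≤? degree G v) V)     ∎
    where open ≡-Reasoning

  degreeSequence-profile : 2 ≤ n → Connected G → Profile (degreeSequence G)
  degreeSequence-profile 2≤n connected = profile-of
    (Sorted⇒AllPairs (Flip.totalOrder ≤-totalOrder) (Descending.sort-↗ degrees))
    (↭.All-resp-↭ (↭-sym sorted↭) (All.map⁺ (All.universal (degree-positive G 2≤n connected) V)))

  -- When the degrees of at least 3 agree, only the mixed pairs contribute, and their doubled sum is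
  -- halved exactly.
  irrₜ-of-profile : ∀ es z a → degreeSequence G ≡ profile es z a → gaps (high es) (high es) ≡ 0 →
                    irrₜ G ≡ mixedGaps (length es) (sum es) z a
  irrₜ-of-profile es z a ds≡ flat = begin
    irrₜ G                                                     ≡⟨ irrₜ-gaps ⟩
    gaps (degreeSequence G) (degreeSequence G) / 2             ≡⟨ cong (λ ds → gaps ds ds / 2) ds≡ ⟩
    gaps (profile es z a) (profile es z a) / 2                 ≡⟨ cong (_/ 2) (gaps-profile es z a) ⟩
    (gaps (high es) (high es) + mixed * 2) / 2                 ≡⟨ cong (λ g → (g + mixed * 2) / 2) flat ⟩
    mixed * 2 / 2                                              ≡⟨ m*n/n≡m mixed 2 ⟩
    mixed                                                      ∎
    where
    open ≡-Reasoning
    mixed = mixedGaps (length es) (sum es) z a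

  -- The discarded pairs contribute a nonnegative amount, and halving is monotone.
  mixedGaps≤irrₜ : ∀ es z a → degreeSequence G ≡ profile es z a →
                   mixedGaps (length es) (sum es) z a ≤ irrₜ G
  mixedGaps≤irrₜ es z a ds≡ = begin
    mixed                                                      ≡⟨ m*n/n≡m mixed 2 ⟨
    mixed * 2 / 2                                              ≤⟨ /-monoˡ-≤ 2 (m≤n+m (mixed * 2) (gaps (high es) (high es))) ⟩
    (gaps (high es) (high es) + mixed * 2) / 2                 ≡⟨ cong (_/ 2) (gaps-profile es z a) ⟨
    gaps (profile es z a) (profile es z a) / 2                 ≡⟨ cong (λ ds → gaps ds ds / 2) ds≡ ⟨
    gaps (degreeSequence G) (degreeSequence G) / 2             ≡⟨ irrₜ-gaps ⟨
    irrₜ G                                                     ∎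
    where
    open ≤-Reasoning
    mixed = mixedGaps (length es) (sum es) z a

-- The two extremal degree sequences and the final comparison.

module _ {m : ℕ} where
  private
    -- In this form `n ∸ 2` and `n ∸ 4` reduce to `3 + m` and `1 + m`, leaving polynomial identities
    -- in `m`.
    n = 5 + m

  mixedGaps-33 : mixedGaps 2 0 (n ∸ 2) 0 ≡ 2 * n ∸ 4
  mixedGaps-33 = trans (sym (m+n∸n≡m _ 4)) (cong (_∸ 4) (identity m))
    where
    identity : ∀ m → (3 + m) * 2 + 0 + (3 + m) * 0 + 4 ≡ 2 * (5 + m)
    identity = solve-∀

  mixedGaps-3331 : mixedGaps 3 0 (n ∸ 4) 1 ≡ 4 * n ∸ 10
  mixedGaps-3331 = trans (sym (m+n∸n≡m _ 10)) (cong (_∸ 10) (identity m))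
    where
    identity : ∀ m → (1 + m) * 3 + 6 + (1 + m) * 1 + 10 ≡ 4 * (5 + m)
    identity = solve-∀

  2n∸4<4n∸10 : 2 * n ∸ 4 < 4 * n ∸ 10
  2n∸4<4n∸10 = subst₂ _<_ mixedGaps-33 mixedGaps-3331
    (subst (mixedGaps 2 0 (n ∸ 2) 0 <_) (identity m) (m<m+n _ z<s))
    where
    identity : ∀ m → (3 + m) * 2 + 0 + (3 + m) * 0 + (4 + 2 * m) ≡ (1 + m) * 3 + 6 + (1 + m) * 1
    identity = solve-∀

  4n<10+r⇒4n∸10<r : ∀ {r} → 4 * n < 10 + r → 4 * n ∸ 10 < r
  4n<10+r⇒4n∸10<r {r} 4n<10+r =
    -- Since 10 ≤ 4n, the successor moves out of the truncated subtraction.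
    subst (_≤ r) (+-∸-assoc 1 {4 * n} {10} 10≤4n) (m≤n+o⇒m∸n≤o (suc (4 * n)) 10 4n<10+r)
    where
    10≤4n : 10 ≤ 4 * n
    10≤4n = ≤-trans (m≤m+n 10 10) (*-monoʳ-≤ 4 (m≤m+n 5 m))

  module _ (G : Graph (Fin n)) where

    Is33 Is3331 : Set
    Is33   = degreeSequence G ≡ 3 ∷ 3 ∷ replicate (n ∸ 2) 2
    Is3331 = degreeSequence G ≡ 3 ∷ 3 ∷ 3 ∷ (replicate (n ∸ 4) 2 ++ 1 ∷ [])

    irrₜ-33 : Is33 → irrₜ G ≡ 2 * n ∸ 4
    irrₜ-33 ds≡ = trans (irrₜ-of-profile G (0 ∷ 0 ∷ []) (n ∸ 2) 0
      -- A profile without leaves still ends in `++ []`. The closing `refl` says that 3 and 3 do not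
      -- differ.
      (trans ds≡ (cong (λ ds → 3 ∷ 3 ∷ ds) (sym (++-identityʳ _)))) refl) mixedGaps-33

    irrₜ-3331 : Is3331 → irrₜ G ≡ 4 * n ∸ 10
    irrₜ-3331 ds≡ = trans (irrₜ-of-profile G (0 ∷ 0 ∷ 0 ∷ []) (n ∸ 4) 1 ds≡ refl) mixedGaps-3331

    module _ (ΘG : Θ n G) where
      open Θ ΘG using (bicyclic)
      open Profile (degreeSequence-profile G (m≤m+n 2 (3 + m)) (proj₁ bicyclic))

      private
        k = length es
        s = sum es

        n≡ : k + (z + a) ≡ n
        n≡ = trans (sym (profile-length es z a))
               (trans (cong length (sym ds≡)) (length-degreeSequence G))

        2≤k : 2 ≤ k
        2≤k = subst (2 ≤_)
          (trans (sym (filter-degreeSequence G))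
            (trans (cong (λ ds → length (filter (3 ≤?_) ds)) ds≡) (filter-profile es z a)))
          (2≤branchings ΘG)

        k+s≡a+2 : k + s ≡ a + 2
        k+s≡a+2 = excess≡deficiency k s z a (begin
          3 * k + s + (z * 2 + a * 1)   ≡⟨ profile-sum es z a ⟨
          sum (profile es z a)          ≡⟨ cong sum ds≡ ⟨
          sum (degreeSequence G)        ≡⟨ sum-degreeSequence G ⟩
          2 * numEdges G                ≡⟨ cong (2 *_) (proj₂ bicyclic) ⟩
          2 * (n + 1)                   ≡⟨ cong (λ n → 2 * (n + 1)) n≡ ⟨
          2 * (k + (z + a) + 1)         ∎)
          where open ≡-Reasoning

        is33 : es ≡ 0 ∷ 0 ∷ [] → a ≡ 0 → Is33
        is33 es≡ a≡0 = trans ds≡ (trans (cong₂ (λ es a → profile es z a) es≡ a≡0)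
          (cong (λ ds → 3 ∷ 3 ∷ ds) (trans (++-identityʳ (replicate z 2)) (cong (λ z → replicate z 2) z≡))))
          where
          z≡ : z ≡ n ∸ 2
          z≡ = trans (sym (+-identityʳ z))
            (cong (_∸ 2) (subst₂ (λ es a → length es + (z + a) ≡ n) es≡ a≡0 n≡))

        is3331 : es ≡ 0 ∷ 0 ∷ 0 ∷ [] → a ≡ 1 → Is3331
        is3331 es≡ a≡1 = trans ds≡ (trans (cong₂ (λ es a → profile es z a) es≡ a≡1)
          (cong (λ z → profile (0 ∷ 0 ∷ 0 ∷ []) z 1) z≡))
          where
          z≡ : z ≡ n ∸ 4
          z≡ = trans (sym (m+n∸n≡m z 1))
            (cong (_∸ 4) (subst₂ (λ es a → length es + (z + a) ≡ n) es≡ a≡1 n≡))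

        4n∸10<irrₜ : 4 * (k + (z + a)) < 10 + mixedGaps k s z a → 4 * n ∸ 10 < irrₜ G
        4n∸10<irrₜ 4n< = <-≤-trans
          (4n<10+r⇒4n∸10<r (subst (λ n → 4 * n < 10 + mixedGaps k s z a) n≡ 4n<))
          (mixedGaps≤irrₜ G es z a ds≡)

      33-or-4n∸10≤irrₜ : Is33 ⊎ (irrₜ G ≥ 4 * n ∸ 10 × (irrₜ G ≡ 4 * n ∸ 10 → Is3331))
      33-or-4n∸10≤irrₜ = conclude (classify es z a 2≤k k+s≡a+2)
        where
        conclude : (es ≡ 0 ∷ 0 ∷ [] × a ≡ 0) ⊎ (es ≡ 0 ∷ 0 ∷ 0 ∷ [] × a ≡ 1) ⊎
                   4 * (k + (z + a)) < 10 + mixedGaps k s z a →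
                   Is33 ⊎ (irrₜ G ≥ 4 * n ∸ 10 × (irrₜ G ≡ 4 * n ∸ 10 → Is3331))
        conclude (inj₁ (es≡ , a≡0)) = inj₁ (is33 es≡ a≡0)
        conclude (inj₂ (inj₁ (es≡ , a≡1))) =
          inj₂ (≤-reflexive (sym (irrₜ-3331 (is3331 es≡ a≡1))) , λ _ → is3331 es≡ a≡1)
        conclude (inj₂ (inj₂ 4n<)) =
          inj₂ (<⇒≤ (4n∸10<irrₜ 4n<) , λ eq → contradiction (sym eq) (<⇒≢ (4n∸10<irrₜ 4n<)))

-- The order-theoretic core: `P` pins `r` to `u`, and otherwise r ≥ v > u, so `r ≡ u` is impossible
-- and only `Q` can give `r ≡ v`.
two-smallest-values : ∀ {r u v} {P Q : Set} → u < v → (P → r ≡ u) → (Q → r ≡ v) →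
  P ⊎ (r ≥ v × (r ≡ v → Q)) → (r ≥ u × (r ≡ u ⇔ P)) × (¬ P → r ≥ v × (r ≡ v ⇔ Q))
two-smallest-values u<v P⇒r≡u Q⇒r≡v (inj₁ p) =
  (≤-reflexive (sym (P⇒r≡u p)) , mk⇔ (λ _ → p) P⇒r≡u) , λ ¬p → contradiction p ¬p
two-smallest-values u<v P⇒r≡u Q⇒r≡v (inj₂ (v≤r , r≡v⇒Q)) =
  (<⇒≤ u<r , mk⇔ (λ r≡u → contradiction (sym r≡u) (<⇒≢ u<r)) P⇒r≡u) ,
  λ _ → v≤r , mk⇔ r≡v⇒Q Q⇒r≡v
  where u<r = <-≤-trans u<v v≤r

theorem14 : (n : ℕ) → 5 ≤ n → (G : Graph (Fin n)) → Θ n G →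
    ( irrₜ G ≥ 2 * n ∸ 4
    × (irrₜ G ≡ 2 * n ∸ 4 ⇔ degreeSequence G ≡ 3 ∷ 3 ∷ replicate (n ∸ 2) 2) )
    ×
    ( degreeSequence G ≢ 3 ∷ 3 ∷ replicate (n ∸ 2) 2 →
    irrₜ G ≥ 4 * n ∸ 10
    × (irrₜ G ≡ 4 * n ∸ 10 ⇔ degreeSequence G ≡ 3 ∷ 3 ∷ 3 ∷ (replicate (n ∸ 4) 2 ++ 1 ∷ [])) )
theorem14 _ (s≤s (s≤s (s≤s (s≤s (s≤s {n = m} _))))) G ΘG =
  two-smallest-values (2n∸4<4n∸10 {m}) (irrₜ-33 G) (irrₜ-3331 G) (33-or-4n∸10≤irrₜ G ΘG)
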